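{- Let $G$ be a countably infinite graph. The following are equivalent: (i) $G$ is ME-homogeneous; (ii) $G$ is HE-homogeneous; (iii) $G$ is MB-homogeneous or $G\cong I_\omega[K_n]$ for some integer $n\geq 2$. In class notation: $\mathrm{ME}=\mathrm{HE}=\mathrm{MB}\cup\{I_\omega[K_n]:n\geq 2\}$.
   Context: All graphs are undirected and loopless; $\sim$ denotes adjacency, and all subgraphs are induced. A homomorphism of graphs maps adjacent vertices to adjacent vertices; a monomorphism is an injective homomorphism; an isomorphism (embedding) is an injective map preserving both adjacency and non-adjacency. For $\mathrm{X}\in\{\mathrm{H},\mathrm{M},\mathrm{I}\}$, an X-morphism is a homomorphism, monomorphism, or isomorphism onto its image, respectively. For $\mathrm{Y}\in\{\mathrm{H},\mathrm{I},\mathrm{A},\mathrm{E},\mathrm{B},\mathrm{M}\}$, a Y-morphism $G\to G$ is, respectively, an endomorphism, a self-embedding, an automorphism, a surjective endomorphism (epimorphism), a bijective endomorphism (bimorphism), or an injective endomorphism. A countable graph $G$ is XY-homogeneous if every X-morphism between finite induced subgraphs of $G$ is the restriction of a Y-morphism $G\to G$. XY also denotes the class of countably infinite XY-homogeneous graphs up to isomorphism. $K_\kappa$ is the complete graph and $I_\kappa$ the edgeless graph on $\kappa$ vertices. For graphs $G,H$, the lexicographic product $G[H]$ has vertex set $G\times H$ with $(g,h)\sim(g',h')$ iff $g\sim g'$ in $G$, or $g=g'$ and $h\sim h'$ in $H$; thus $I_\omega[K_n]$ is the disjoint union of countably many copies of $K_n$. -}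

module Defs where

open import Data.Empty using (⊥)
open import Data.Fin using (Fin)
open import Data.Nat using (ℕ)
open import Data.Product using (Σ-syntax; ∃-syntax; _×_; _,_; proj₁; proj₂)
open import Data.Sum using (_⊎_; inj₁; inj₂)
open import Function.Bundles using (_↔_; _↣_; module Injection)
open import Function.Definitions using (Injective; Surjective; Bijective)
open import Level using (0ℓ)
open import Relation.Binary.Core using (Rel)
open import Relation.Binary.Definitions using (Irreflexive; Symmetric)
open import Relation.Binary.PropositionalEquality using (_≡_; _≢_; refl; sym; ≢-sym)
open import Relation.Nullary using (¬_)

-- Adjacency proofs carry no information: everything below depends on _∼_
-- only up to logical equivalence, so parallel edges are not modelled.
record Graph : Set₁ where
  infix 4 _∼_
  field
    Vertex   : Set
    _∼_      : Rel Vertex 0ℓ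
    loopless : Irreflexive _≡_ _∼_
    ∼-sym    : Symmetric _∼_

open Graph using (Vertex)

CountablyInfinite : Graph → Set
CountablyInfinite G = Vertex G ↔ ℕ

module _ (G H : Graph) where
  private
    module G = Graph G
    module H = Graph H

  IsHomomorphism : (G.Vertex → H.Vertex) → Set
  IsHomomorphism f = ∀ x y → x G.∼ y → f x H.∼ f y

  PreservesNonAdjacency : (G.Vertex → H.Vertex) → Set
  PreservesNonAdjacency f = ∀ x y → ¬ (x G.∼ y) → ¬ (f x H.∼ f y)

  IsMonomorphism : (G.Vertex → H.Vertex) → Set
  IsMonomorphism f = IsHomomorphism f × Injective _≡_ _≡_ f

  IsEmbedding : (G.Vertex → H.Vertex) → Set
  IsEmbedding f = IsMonomorphism f × PreservesNonAdjacency f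

  infix 4 _≅_
  _≅_ : Set
  _≅_ = Σ[ f ∈ (G.Vertex → H.Vertex) ] (IsEmbedding f × Surjective _≡_ _≡_ f)

data LocalKind : Set where
  H M I : LocalKind

data GlobalKind : Set where
  H I A E B M : GlobalKind

IsLocalMorphism : LocalKind → (G K : Graph) → (Vertex G → Vertex K) → Set
IsLocalMorphism H = IsHomomorphism
IsLocalMorphism M = IsMonomorphism
IsLocalMorphism I = IsEmbedding

IsGlobalMorphism : GlobalKind → (G : Graph) → (Vertex G → Vertex G) → Set
IsGlobalMorphism H G f = IsHomomorphism G G f
IsGlobalMorphism I G f = IsEmbedding G G f
IsGlobalMorphism A G f = IsEmbedding G G f × Surjective _≡_ _≡_ f
IsGlobalMorphism E G f = IsHomomorphism G G f × Surjective _≡_ _≡_ f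
IsGlobalMorphism B G f = IsHomomorphism G G f × Bijective _≡_ _≡_ f
IsGlobalMorphism M G f = IsMonomorphism G G f

-- A finite set of vertices is presented by a repetition-free enumeration
-- Fin n ↣ Vertex G; the subgraph it induces has the indices as vertices.
FiniteVertexSet : Graph → Set
FiniteVertexSet G = ∃[ n ] (Fin n ↣ Vertex G)

module _ {G : Graph} where
  private module G = Graph G

  vertexAt : (S : FiniteVertexSet G) → Fin (proj₁ S) → G.Vertex
  vertexAt (_ , e) = Injection.to e

  induced : FiniteVertexSet G → Graph
  induced S = record
    { Vertex   = Fin (proj₁ S)
    ; _∼_      = λ i j → vertexAt S i G.∼ vertexAt S j
    ; loopless = λ { refl → G.loopless refl }
    ; ∼-sym    = G.∼-sym
    }

Homogeneous : LocalKind → GlobalKind → Graph → Set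
Homogeneous X Y G =
  (S T : FiniteVertexSet G) (f : Vertex (induced {G} S) → Vertex (induced {G} T)) →
  IsLocalMorphism X (induced {G} S) (induced {G} T) f →
  Σ[ F ∈ (Vertex G → Vertex G) ]
    (IsGlobalMorphism Y G F × (∀ i → F (vertexAt {G} S i) ≡ vertexAt {G} T (f i)))

complete : Set → Graph
complete κ = record
  { Vertex   = κ
  ; _∼_      = _≢_
  ; loopless = λ x≡y x≢y → x≢y x≡y
  ; ∼-sym    = ≢-sym
  }

edgeless : Set → Graph
edgeless κ = record
  { Vertex   = κ
  ; _∼_      = λ _ _ → ⊥
  ; loopless = λ _ ()
  ; ∼-sym    = λ ()
  }

infix 8 _[_]
_[_] : Graph → Graph → Graph
G [ K ] = record
  { Vertex   = G.Vertex × K.Vertex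
  ; _∼_      = λ (g , k) (g′ , k′) → (g G.∼ g′) ⊎ (g ≡ g′ × k K.∼ k′)
  ; loopless = λ { refl (inj₁ g∼g)       → G.loopless refl g∼g
                 ; refl (inj₂ (_ , k∼k)) → K.loopless refl k∼k }
  ; ∼-sym    = λ { (inj₁ g∼g′)          → inj₁ (G.∼-sym g∼g′)
                 ; (inj₂ (g≡g′ , k∼k′)) → inj₂ (sym g≡g′ , K.∼-sym k∼k′) }
  }
  where
  module G = Graph G
  module K = Graph K

{-# OPTIONS --safe #-}
module Submission where

-- A back-and-forth construction reduces each kind of homogeneity to one-point extensions of
-- finite partial maps.  An ME-homogeneous graph G extends partial homomorphisms forward, and
-- surjectivity gives the same extension property for the complement of G.  These two properties
-- alone force: one of G and its complement is coned (every finite set of vertices has a common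
-- neighbour); and if the complement is coned, then G is coned or a disjoint union of complete
-- graphs, as is seen from the largest independent sets having a common neighbour.  Applied to G
-- this leaves the MB-homogeneous graphs and the I_ω[K_n]; applied to the complement it shows
-- that surjective extension survives when the partial map is not injective, hence HE.

open import Axiom.ExcludedMiddle using (ExcludedMiddle)
open import Data.Empty using (⊥; ⊥-elim)
open import Data.Fin using (Fin; zero; suc; toℕ; fromℕ<)
open import Data.Fin.Properties as Fin using (toℕ<n; fromℕ<-cong; fromℕ<-toℕ; pigeonhole)
open import Data.List.Base using (List; []; _∷_; _++_; map; length; lookup; tabulate; filter; take)
open import Data.List.Membership.Propositional using (_∈_; _∉_; find)
open import Data.List.Membership.Propositional.Properties using (∈-filter⁺; ∈-filter⁻; ∈-lookup; ∈-++⁺ˡ; ∈-++⁺ʳ)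
open import Data.List.Properties using (length-map; length-take)
open import Data.List.Relation.Unary.All as All using (All; []; _∷_)
import Data.List.Relation.Unary.All.Properties as All
open import Data.List.Relation.Unary.AllPairs as AllPairs using (AllPairs; []; _∷_)
import Data.List.Relation.Unary.AllPairs.Properties as AllPairs
open import Data.List.Relation.Unary.Any as Any using (Any; here; there)
open import Data.List.Relation.Unary.Any.Properties using (lookup-index)
open import Data.List.Relation.Unary.Unique.Propositional using (Unique)
open import Data.Nat using (ℕ; zero; suc; _+_; _*_; _⊔_; _≤_; _<_; _≥_; z≤n; s≤s; _/_; _%_; NonZero)
open import Data.Nat.Divisibility using (n∣m*n)
open import Data.Nat.DivMod
  using (m%n<n; +-distrib-/-∣ˡ; m*n/n≡m; m<n⇒m/n≡0; m<n⇒m%n≡m; [m+kn]%n≡m%n)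
open import Data.Nat.Properties
  using (suc-injective; +-comm; +-suc; +-identityʳ; ≤-trans; ≤-reflexive; <-irrefl; ≮⇒≥;
         m≤m⊔n; m≤n⊔m; m≤n⇒m⊓n≡m)
open import Data.Product using (Σ-syntax; ∃-syntax; _×_; _,_; proj₁; proj₂; swap)
open import Data.Sum using (_⊎_; inj₁; inj₂; [_,_]′)
open import Function.Base using (_∘_; id; case_of_)
open import Function.Bundles using (_⇔_; mk⇔; mk↣; Inverse; Injection)
open import Function.Definitions using (Surjective)
open import Level using (0ℓ)
open import Relation.Binary.Core using (Rel)
open import Relation.Binary.Definitions using (Symmetric)
open import Relation.Binary.PropositionalEquality
  using (_≡_; _≢_; refl; sym; trans; cong; cong₂; subst; ≢-sym)
open import Relation.Nullary using (¬_; yes; no; contradiction)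
open import Relation.Nullary.Decidable using (decidable-stable)
open import Defs

open Graph using () renaming (Vertex to V⟨_⟩)

private variable
  V : Set
  R : Rel V 0ℓ
  xs : List V

-- Lists of pairwise related elements, and avoidance of finite sets.

Enumerable : Set → Set
Enumerable V = Σ[ e ∈ (ℕ → V) ] (∀ a → ∃[ n ] e n ≡ a)

lookup-related : Symmetric R → AllPairs R xs → ∀ {i j} → i ≢ j → R (lookup xs i) (lookup xs j)
lookup-related sy (r ∷ rs) {zero}  {zero}  i≢j = contradiction refl i≢j
lookup-related sy (r ∷ rs) {zero}  {suc j} i≢j = All.lookup r (∈-lookup j)
lookup-related sy (r ∷ rs) {suc i} {zero}  i≢j = sy (All.lookup r (∈-lookup i))
lookup-related sy (r ∷ rs) {suc i} {suc j} i≢j = lookup-related sy rs (i≢j ∘ cong suc)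

∈-related : Symmetric R → AllPairs R xs → ∀ {x y} → x ∈ xs → y ∈ xs → x ≢ y → R x y
∈-related sy (r ∷ rs) (here refl) (here refl) x≢y = contradiction refl x≢y
∈-related sy (r ∷ rs) (here refl) (there y∈)  x≢y = All.lookup r y∈
∈-related sy (r ∷ rs) (there x∈)  (here refl) x≢y = sy (All.lookup r x∈)
∈-related sy (r ∷ rs) (there x∈)  (there y∈)  x≢y = ∈-related sy rs x∈ y∈ x≢y

AllPairs-All : ∀ {P : V → Set} → AllPairs R xs → All P xs →
  AllPairs (λ x y → P x × P y × R x y) xs
AllPairs-All []       []       = []
AllPairs-All (r ∷ rs) (p ∷ ps) = All.zipWith (λ (q , s) → p , q , s) (ps , r) ∷ AllPairs-All rs ps

infinite-avoid : (g : V → ℕ) → (∀ n → ∃[ a ] g a ≡ n) → ∀ xs → ∃[ a ] All (λ x → g a ≢ g x) xs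
infinite-avoid g g-surj xs =
  let a , ga≡ = g-surj (suc (bound xs)) in
  a , All.map (λ gx≤ ga≡gx → <-irrefl refl (≤-trans (≤-reflexive (trans (sym ga≡) ga≡gx)) gx≤)) (bounded xs)
  where
  bound : List _ → ℕ
  bound []       = 0
  bound (x ∷ xs) = g x ⊔ bound xs
  bounded : ∀ xs → All (λ x → g x ≤ bound xs) xs
  bounded []       = []
  bounded (x ∷ xs) = m≤m⊔n (g x) (bound xs) ∷ All.map (λ p → ≤-trans p (m≤n⊔m (g x) (bound xs))) (bounded xs)

-- Complements, finite partial maps and one-point extension properties.

complement : Graph → Graph
complement G = record
  { Vertex   = V⟨ G ⟩
  ; _∼_      = λ x y → x ≢ y × ¬ x ∼ y
  ; loopless = λ x≡y (x≢y , _) → x≢y x≡y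
  ; ∼-sym    = λ (x≢y , x≁y) → ≢-sym x≢y , x≁y ∘ ∼-sym
  }
  where open Graph G

-- A list of pairs, pairwise related by one of these, is a finite partial map of that kind.
HomRel MonoRel IsoRel : (G K : Graph) → Rel (V⟨ G ⟩ × V⟨ K ⟩) 0ℓ
HomRel G K (x , y) (x′ , y′) = x ≢ x′ × (x ∼G x′ → y ∼K y′)
  where
  _∼G_ = Graph._∼_ G
  _∼K_ = Graph._∼_ K
MonoRel G K (x , y) (x′ , y′) = x ≢ x′ × y ≢ y′ × (x ∼G x′ → y ∼K y′)
  where
  _∼G_ = Graph._∼_ G
  _∼K_ = Graph._∼_ K
IsoRel G K (x , y) (x′ , y′) = x ≢ x′ × y ≢ y′ × (x ∼G x′ → y ∼K y′) × (y ∼K y′ → x ∼G x′)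
  where
  _∼G_ = Graph._∼_ G
  _∼K_ = Graph._∼_ K

module _ (G K : Graph) where
  private
    module G = Graph G
    module K = Graph K

  HomRel-sym : Symmetric (HomRel G K)
  HomRel-sym (x≢ , h) = ≢-sym x≢ , K.∼-sym ∘ h ∘ G.∼-sym

  MonoRel-sym : Symmetric (MonoRel G K)
  MonoRel-sym (x≢ , y≢ , h) = ≢-sym x≢ , ≢-sym y≢ , K.∼-sym ∘ h ∘ G.∼-sym

  IsoRel-swap : ∀ {p q} → IsoRel G K p q → IsoRel K G (swap p) (swap q)
  IsoRel-swap (x≢ , y≢ , h , h⁻¹) = y≢ , x≢ , h⁻¹ , h

  IsoRel-sym : Symmetric (IsoRel G K)
  IsoRel-sym (x≢ , y≢ , h , h⁻¹) = ≢-sym x≢ , ≢-sym y≢ , K.∼-sym ∘ h ∘ G.∼-sym , G.∼-sym ∘ h⁻¹ ∘ K.∼-sym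

module _ (G : Graph) where
  open Graph G

  Clique : List Vertex → Set
  Clique = AllPairs _∼_

  Coned : Set
  Coned = ∀ L → ∃[ u ] All (u ∼_) L

  -- Equivalently, a disjoint union of complete graphs.
  Cluster : Set
  Cluster = ∀ u {x y} → u ∼ x → u ∼ y → x ≡ y ⊎ x ∼ y

  -- The case that `v` is itself a source is included; its image then serves as `w`.
  Extensible : Set
  Extensible = ∀ L → AllPairs (HomRel G G) L → ∀ v →
    ∃[ w ] All (λ (x , y) → v ∼ x → w ∼ y) L

  BackExtensible : Set
  BackExtensible = ∀ L → AllPairs (MonoRel G G) L → ∀ w → All (λ p → w ≢ proj₂ p) L →
    ∃[ v ] All (λ (x , y) → v ≢ x × (v ∼ x → w ∼ y)) L

  HomBackExtensible : Set
  HomBackExtensible = ∀ L → AllPairs (HomRel G G) L → ∀ w → All (λ p → w ≢ proj₂ p) L →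
    ∃[ v ] All (λ (x , y) → v ≢ x × (v ∼ x → w ∼ y)) L

  CliquesOfAllSizes : Set
  CliquesOfAllSizes = ∀ n → ∃[ K ] (Clique K × length K ≡ n)

Independent : (G : Graph) → List V⟨ G ⟩ → Set
Independent G = Clique (complement G)

-- Moving common neighbours along partial homomorphisms.

module Transfer (G : Graph) (ext : Extensible G) where
  open Graph G

  -- `Z` has no edges inside it and none to the sources of `L`, so any pairing of it with `W`, even
  -- with repetitions in `W`, keeps the map a partial homomorphism. The vertex sought is an image of
  -- `v`.
  transfer : ∀ L → AllPairs (HomRel G G) L → ∀ {v} → All (λ p → v ∼ proj₁ p) L →
    ∀ Z W → length Z ≡ length W → Independent G Z →
    All (λ z → All (λ p → Graph._∼_ (complement G) z (proj₁ p)) L) Z → All (v ∼_) Z →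
    ∃[ u ] (All (λ p → u ∼ proj₂ p) L × All (u ∼_) W)
  transfer L hom {v} v∼L [] [] _ _ _ _ =
    let u , u∼ = ext L hom v in u , All.zipWith (λ (f , p) → f p) (u∼ , v∼L) , []
  transfer L hom v∼L (z ∷ Z) (w ∷ W) eq (z⟂Z ∷ indZ) (z⟂L ∷ Z⟂L) (v∼z ∷ v∼Z) =
    let u , u∼wL , u∼W = transfer ((z , w) ∷ L)
          (All.map (λ (z≢x , z≁x) → z≢x , λ z∼x → contradiction z∼x z≁x) z⟂L ∷ hom) (v∼z ∷ v∼L)
          Z W (suc-injective eq) indZ
          (All.zipWith (λ (z⟂z′ , z′⟂L) → Graph.∼-sym (complement G) z⟂z′ ∷ z′⟂L) (z⟂Z , Z⟂L)) v∼Z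
    in u , All.tail u∼wL , All.head u∼wL ∷ u∼W

  -- A clique as target preserves whatever edges the distinct sources have.
  zipClique : ∀ N K → Unique N → Clique G K → length N ≡ length K →
    ∃[ L ] (AllPairs (HomRel G G) L × map proj₁ L ≡ N × map proj₂ L ≡ K)
  zipClique [] [] _ _ _ = [] , [] , refl , refl
  zipClique (x ∷ N) (k ∷ K) (x≢N ∷ uniq) (k∼K ∷ cl) eq
    with L , hom , refl , refl ← zipClique N K uniq cl (suc-injective eq) =
    (x , k) ∷ L ,
    All.zipWith (λ (x≢ , k∼) → x≢ , λ _ → k∼) (All.map⁻ x≢N , All.map⁻ k∼K) ∷ hom , refl , refl

  cliqueTransfer : ∀ {N K v} → Unique N → Clique G K → length N ≡ length K → All (v ∼_) N →
    ∃[ u ] All (u ∼_) K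
  cliqueTransfer {N} {K} {v} uniq cl eq v∼N with L , hom , refl , refl ← zipClique N K uniq cl eq =
    let u , u∼ = ext L hom v in
    u , All.map⁺ (All.zipWith (λ (f , p) → f p) (u∼ , All.map⁻ v∼N))

-- Graphs with coned complement.

module _ (G : Graph) (coned′ : Coned (complement G)) where
  open Graph G
  open Graph (complement G) using () renaming (_∼_ to _⟂_)

  fresh : ∀ n L → ∃[ Z ] (length Z ≡ n × Independent G Z × All (λ z → All (z ⟂_) L) Z)
  fresh zero    L = [] , refl , [] , []
  fresh (suc n) L =
    let Z , len , ind , Z⟂L = fresh n L
        z , z⟂ = coned′ (Z ++ L)
        z⟂Z , z⟂L = All.++⁻ Z z⟂
    in z ∷ Z , cong suc len , z⟂Z ∷ ind , z⟂L ∷ Z⟂L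

-- A new vertex nonadjacent to all sources has no edges to preserve.
coned′⇒homBack : ∀ G → Coned (complement G) → HomBackExtensible G
coned′⇒homBack G coned′ L _ w _ =
  let v , v⟂ = coned′ (map proj₁ L) in
  v , All.map (λ (v≢x , v≁x) → v≢x , λ v∼x → contradiction v∼x v≁x) (All.map⁻ v⟂)

-- Independent sets inside neighbourhoods.

-- Here s = t + 2 is the largest size of an independent set with a common neighbour.
module Fans (em : ExcludedMiddle 0ℓ) (G : Graph) (ext : Extensible G)
  (coned′ : Coned (complement G)) (t : ℕ)
  (pos : ∀ e → Independent G e → length e ≡ suc (suc t) → ∃[ u ] All (Graph._∼_ G u) e)
  (neg : ∀ e u → Independent G e → length e ≡ suc (suc (suc t)) → ¬ All (Graph._∼_ G u) e) where
  open Graph G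
  open Graph (complement G) using () renaming (_∼_ to _⟂_; ∼-sym to ⟂-sym)
  open Transfer G ext

  fresh′ : ∀ n L → ∃[ Z ] (length Z ≡ n × Independent G Z × All (λ z → All (z ⟂_) L) Z)
  fresh′ = fresh G coned′

  ∼⟂⇒≢ : ∀ {c x y} → c ∼ y → x ⟂ y → c ≢ x
  ∼⟂⇒≢ c∼y (_ , x≁y) refl = x≁y c∼y

  -- Otherwise `x ∷ e` would be an independent (s + 1)-set of neighbours of `c`.
  saturated : ∀ {e c x} → Independent G e → length e ≡ suc (suc t) → All (c ∼_) e →
    All (x ⟂_) e → c ⟂ x
  saturated {e@(_ ∷ _)} {c} {x} ind len c∼e@(c∼y ∷ _) x⟂e@(x⟂y ∷ _) =
    ∼⟂⇒≢ c∼y x⟂y , λ c∼x → neg (x ∷ e) c (x⟂e ∷ ind) (cong suc len) (c∼x ∷ c∼e)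

  hit : ∀ {e c u} → Independent G e → length e ≡ suc (suc t) → All (c ∼_) e →
    c ∼ u → All (u ≢_) e → Any (u ∼_) e
  hit {e} {c} {u} ind len c∼e c∼u u≢e with em {Any (u ∼_) e}
  ... | yes any = any
  ... | no none = contradiction c∼u
    (proj₂ (saturated ind len c∼e (All.zipWith id (u≢e , All.¬Any⇒All¬ e none))))

  -- `W` has s - 1 members, so that with a single vertex of `K` it makes s. For `fan₁` a transfer
  -- from an independent s-set therefore suffices.
  FanExtension : ℕ → Set
  FanExtension m = ∀ K W → Clique G K → length K ≡ m → length W ≡ suc t →
    ∃[ u ] (All (u ∼_) K × All (u ∼_) W)

  fan₁ : FanExtension 1
  fan₁ (k ∷ []) W _ _ lenW =
    let Z , lenZ , indZ , _ = fresh′ (suc (suc t)) []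
        v , v∼Z = pos Z indZ lenZ
        u , _ , u∼W = transfer [] [] {v} [] Z (k ∷ W) (trans lenZ (cong suc (sym lenW))) indZ
                        (All.tabulate (λ _ → [])) v∼Z
    in u , All.head u∼W ∷ [] , All.tail u∼W

  -- Among s + 1 vertices, each completing K together with its own private fan, two are adjacent
  -- since a neighbourhood contains no independent (s + 1)-set; these two enlarge K.
  fan-step : ∀ {m} → FanExtension (suc m) → FanExtension (suc (suc m))
  fan-step {m} fan K@(k ∷ K₀@(k₀ ∷ _)) W cl@(_ ∷ cl₀) lenK lenW =
    fill (completions (suc (suc (suc t))))
    where
    Enlarged : Set
    Enlarged = ∃[ v ] ∃[ a ] ∃[ Z ] (All (a ∼_) K₀ × All (v ∼_) (a ∷ K₀) ×
      length Z ≡ suc t × Independent G Z × All (λ z → All (z ⟂_) (a ∷ K₀)) Z × All (v ∼_) Z)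

    completions : ∀ j → Enlarged ⊎ ∃[ As ] (length As ≡ j × Independent G As × All (λ a → All (a ∼_) K₀) As)
    completions zero = inj₂ ([] , refl , [] , [])
    completions (suc j) with completions j
    ... | inj₁ done = inj₁ done
    ... | inj₂ (As , lenAs , indAs , As∼K)
      with fresh′ (suc t) (As ++ K₀)
    ... | Z@(_ ∷ _) , lenZ , indZ , Z⟂@(z⟂ ∷ _)
      with fan K₀ Z cl₀ (suc-injective lenK) lenZ
    ... | v , v∼K , v∼Z@(v∼z ∷ _) with em {Any (v ∼_) As}
    ... | yes any = inj₁ (v , Any.lookup any , Z , All.lookupAny As∼K any .proj₁ ,
            All.lookupAny As∼K any .proj₂ ∷ v∼K , lenZ , indZ ,
            All.map (λ z⟂AsK → let z⟂As , z⟂K = All.++⁻ As z⟂AsK in All.lookupAny z⟂As any .proj₁ ∷ z⟂K) Z⟂ ,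
            v∼Z)
    ... | no none = inj₂ (v ∷ As , cong suc lenAs ,
            -- The new `v` differs from the earlier vertices because it is adjacent to its own `z`
            -- and they are not.
            All.zipWith (λ (z⟂a , v≁a) → ∼⟂⇒≢ v∼z (⟂-sym z⟂a) , v≁a)
              (All.++⁻ˡ As z⟂ , All.¬Any⇒All¬ As none) ∷ indAs ,
            v∼K ∷ As∼K)

    fill : Enlarged ⊎ _ → ∃[ u ] (All (u ∼_) K × All (u ∼_) W)
    fill (inj₂ (As , lenAs , indAs , As∼K)) =
      contradiction (All.map (λ { (a∼k₀ ∷ _) → ∼-sym a∼k₀ }) As∼K) (neg As k₀ indAs lenAs)
    fill (inj₁ (v , a , Z , a∼K₀ , v∼ , lenZ , indZ , Z⟂ , v∼Z))
      -- The clique `a ∷ K₀` has the size of `K` and is mapped onto it, while the fan `Z` is mapped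
      -- to `W`; the image of `v` is as required.
      with L , hom , srcL , tgtL ← zipClique (a ∷ K₀) K
             (AllPairs.map (λ { a∼a refl → loopless refl a∼a }) (a∼K₀ ∷ cl₀)) cl refl =
      let u , u∼K , u∼W = transfer L hom
            (All.map⁻ (subst (All (v ∼_)) (sym srcL) v∼)) Z W (trans lenZ (sym lenW)) indZ
            (All.map (λ z⟂ → All.map⁻ (subst (All _) (sym srcL) z⟂)) Z⟂) v∼Z
      in u , subst (All (u ∼_)) tgtL (All.map⁺ u∼K) , u∼W

  fan₂ : FanExtension 2
  fan₂ = fan-step fan₁

  fan₃ : FanExtension 3
  fan₃ = fan-step fan₂

  columns : ∀ {L Z} → All (λ z → All (z ⟂_) L) Z → ∀ {x} → x ∈ L → All (x ⟂_) Z
  columns Z⟂L x∈L = All.map (λ z⟂L → ⟂-sym (All.lookup z⟂L x∈L)) Z⟂L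

  ⟂⇒HomRel : ∀ {x x′ y y′} → x ⟂ x′ → HomRel G G (x , y) (x′ , y′)
  ⟂⇒HomRel (x≢x′ , x≁x′) = x≢x′ , λ x∼x′ → contradiction x∼x′ x≁x′

  ∼⇒HomRel : ∀ {x x′ y y′} → x ∼ x′ → y ∼ y′ → HomRel G G (x , y) (x′ , y′)
  ∼⇒HomRel x∼x′ y∼y′ = (λ x≡x′ → loopless x≡x′ x∼x′) , λ _ → y∼y′

  -- The source of the transfer is a common neighbour v of Z and of two edges pa and qb that
  -- induce a matching, so that the edges of the target can be arbitrary beyond wx and yz.
  matchingFan : ∀ {w x y z} W → w ∼ x → y ∼ z → length W ≡ t →
    ∃[ u ] ((u ∼ w × u ∼ x × u ∼ y × u ∼ z) × All (u ∼_) W)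
  matchingFan {w} {x} {y} {z} W w∼x y∼z lenW
    with e@(p ∷ q ∷ Z) , lenE , indE@((p⟂q ∷ p⟂Z) ∷ q⟂Z ∷ indZ) , _ ← fresh′ (suc (suc t)) []
    with v , v∼e@(v∼p ∷ v∼q ∷ v∼Z) ← pos e indE lenE
    with N , lenN , indN , N⟂ ← fresh′ (suc t) (v ∷ e)
    with a , a∼v ∷ a∼p ∷ [] , a∼N ← fan₂ (v ∷ p ∷ []) N ((v∼p ∷ []) ∷ [] ∷ []) refl lenN
    with O , lenO , indO , O⟂ ← fresh′ (suc t) ((v ∷ e) ++ N)
    with b , b∼v ∷ b∼q ∷ [] , b∼O ← fan₂ (v ∷ q ∷ []) O ((v∼q ∷ []) ∷ [] ∷ []) refl lenO
    = let u , u∼wxyz , u∼W = transfer ((p , w) ∷ (a , x) ∷ (b , y) ∷ (q , z) ∷ [])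
            ((∼⇒HomRel (∼-sym a∼p) w∼x ∷ ⟂⇒HomRel (⟂-sym b⟂p) ∷ ⟂⇒HomRel p⟂q ∷ [])
              ∷ (⟂⇒HomRel (⟂-sym b⟂a) ∷ ⟂⇒HomRel (a⟂ (⟂-sym p⟂q ∷ columns N⟂ (there (there (here refl))))) ∷ [])
              ∷ (∼⇒HomRel b∼q y∼z ∷ [])
              ∷ [] ∷ [])
            (v∼p ∷ ∼-sym a∼v ∷ ∼-sym b∼v ∷ v∼q ∷ [])
            Z W (trans (suc-injective (suc-injective lenE)) (sym lenW)) indZ
            (All.tabulate (λ z∈ →
                 let z⟂p = ⟂-sym (All.lookup p⟂Z z∈)
                     z⟂q = ⟂-sym (All.lookup q⟂Z z∈)
                     z∈e = there (there (there z∈))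
                 in z⟂p ∷ ⟂-sym (a⟂ (z⟂p ∷ columns N⟂ z∈e)) ∷ ⟂-sym (b⟂ (z⟂q ∷ columns O⟂ (∈-++⁺ˡ z∈e))) ∷ z⟂q ∷ []))
            v∼Z
      in u , (All.head u∼wxyz , All.head (All.tail u∼wxyz) , All.head (All.tail (All.tail u∼wxyz)) ,
              All.head (All.tail (All.tail (All.tail u∼wxyz)))) , u∼W
    where
    a⟂ : ∀ {x} → All (x ⟂_) (p ∷ N) → a ⟂ x
    a⟂ = saturated (columns N⟂ (there (here refl)) ∷ indN) (cong suc lenN) (a∼p ∷ a∼N)
    b⟂ : ∀ {x} → All (x ⟂_) (q ∷ O) → b ⟂ x
    b⟂ = saturated (columns O⟂ (there (there (here refl))) ∷ indO) (cong suc lenO) (b∼q ∷ b∼O)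
    b⟂p : b ⟂ p
    b⟂p = b⟂ (p⟂q ∷ columns O⟂ (there (here refl)))
    -- Saturation is used twice: `a` is nonadjacent to `b` once `b` is nonadjacent to the whole fan
    -- `p ∷ N` of `a`, and each member of that fan is nonadjacent to the fan `q ∷ O` of `b`.
    b⟂a : b ⟂ a
    b⟂a = ⟂-sym (a⟂ (b⟂p ∷ All.tabulate (λ x∈N →
      b⟂ (⟂-sym (All.lookup (columns N⟂ (there (there (here refl)))) x∈N) ∷ columns O⟂ (∈-++⁺ʳ (v ∷ e) x∈N)))))

  -- The pairwise adjacent vertices a, b, c have fans eᵃ, eᵇ, eᶜ with no element common to all
  -- three. A common neighbour u of a, b, c and of a fresh independent (s - 1)-set Q meets each
  -- fan, hence two different elements of them, and together with Q these form an independent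
  -- (s + 1)-set.
  impossible : ⊥
  impossible
    with eᵃ@(p ∷ q ∷ Z) , lenᵃ , indᵃ@((p⟂q ∷ p⟂Z) ∷ q⟂Z ∷ indZ) , _ ← fresh′ (suc (suc t)) []
    with a , a∼eᵃ@(a∼p ∷ a∼q ∷ a∼Z) ← pos eᵃ indᵃ lenᵃ
    with rZ′@(r ∷ Z′) , lenZ′ , indZ′ , Z′⟂ ← fresh′ (suc t) (a ∷ eᵃ)
    with b , b∼a ∷ b∼p ∷ [] , b∼Z′@(b∼r ∷ _)
           ← fan₂ (a ∷ p ∷ []) rZ′ ((a∼p ∷ []) ∷ [] ∷ []) refl lenZ′
    with Z″ , lenZ″ , indZ″ , Z″⟂ ← fresh′ t (eᵃ ++ rZ′)
    -- `c` has to see the adjacent pair `a`, `b` as well as `q` and `r`; these four are covered by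
    -- the edges `qa` and `br`.
    with c , (c∼q , c∼a , c∼b , c∼r) , c∼Z″ ← matchingFan Z″ (∼-sym a∼q) b∼r lenZ″
    with Q@(_ ∷ _) , lenQ , indQ , Q⟂ ← fresh′ (suc t) ((eᵃ ++ rZ′) ++ Z″)
    with u , u∼a ∷ u∼b ∷ u∼c ∷ [] , u∼Q@(u∼x ∷ _)
           ← fan₃ (a ∷ b ∷ c ∷ []) Q
               ((∼-sym b∼a ∷ ∼-sym c∼a ∷ []) ∷ (∼-sym c∼b ∷ []) ∷ [] ∷ []) refl lenQ
    = meet (find (hit indᵃ lenᵃ a∼eᵃ (∼-sym u∼a) (apart inᵃ)))
    where
    Y = (eᵃ ++ rZ′) ++ Z″
    p⟂Z′ : All (p ⟂_) rZ′
    p⟂Z′ = columns Z′⟂ (there (here refl))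
    q⟂Z′ : All (q ⟂_) rZ′
    q⟂Z′ = columns Z′⟂ (there (there (here refl)))
    eᵇ eᶜ : List _
    eᵇ = p ∷ rZ′
    eᶜ = q ∷ r ∷ Z″
    inᵃ : ∀ {y} → y ∈ eᵃ → y ∈ Y
    inᵃ = ∈-++⁺ˡ ∘ ∈-++⁺ˡ
    inᵇ : ∀ {y} → y ∈ eᵇ → y ∈ Y
    inᵇ (here refl) = here refl
    inᵇ (there y∈)  = ∈-++⁺ˡ (∈-++⁺ʳ eᵃ y∈)
    inᶜ : ∀ {y} → y ∈ eᶜ → y ∈ Y
    inᶜ (here refl)         = there (here refl)
    inᶜ (there (here refl)) = inᵇ (there (here refl))
    inᶜ (there (there y∈))  = ∈-++⁺ʳ (eᵃ ++ rZ′) y∈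
    -- `u` has a neighbour in `Q`, to which no vertex of `Y` is adjacent, so `u` lies outside the
    -- fans, as `hit` demands.
    apart : ∀ {e} → (∀ {y} → y ∈ e → y ∈ Y) → All (u ≢_) e
    apart e⊆Y = All.tabulate (λ y∈ → ∼⟂⇒≢ u∼x (All.head (columns Q⟂ (e⊆Y y∈))))
    clash : ∀ {x y} → x ∈ Y → y ∈ Y → u ∼ x → u ∼ y → x ⟂ y → ⊥
    clash {x} {y} x∈ y∈ u∼x u∼y x⟂y = neg (x ∷ y ∷ Q) u
      ((x⟂y ∷ columns Q⟂ x∈) ∷ columns Q⟂ y∈ ∷ indQ) (cong (2 +_) lenQ) (u∼x ∷ u∼y ∷ u∼Q)
    clashes : ∀ {x e} → x ∈ Y → u ∼ x → All (x ⟂_) e → (∀ {y} → y ∈ e → y ∈ Y) → Any (u ∼_) e → ⊥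
    clashes x∈ u∼x x⟂e e⊆Y any =
      let y , y∈ , u∼y = find any in clash x∈ (e⊆Y y∈) u∼x u∼y (All.lookup x⟂e y∈)
    meetsᵇ : Any (u ∼_) eᵇ
    meetsᵇ = hit (p⟂Z′ ∷ indZ′) (cong suc lenZ′) (b∼p ∷ b∼Z′) (∼-sym u∼b) (apart inᵇ)
    meetsᶜ : Any (u ∼_) eᶜ
    meetsᶜ = hit ((All.head q⟂Z′ ∷ columns Z″⟂ (there (here refl))) ∷ columns Z″⟂ (∈-++⁺ʳ eᵃ (here refl)) ∷ indZ″)
      (cong (2 +_) lenZ″) (c∼q ∷ c∼r ∷ c∼Z″) (∼-sym u∼c) (apart inᶜ)
    -- Every element of `eᵃ` is nonadjacent to all of another fan that omits it: `p` to `eᶜ`, the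
    -- others to `eᵇ`.
    meet : (∃[ y ] (y ∈ eᵃ × u ∼ y)) → ⊥
    meet (_ , y∈@(here refl) , u∼p) =
      clashes (inᵃ y∈) u∼p (p⟂q ∷ All.head p⟂Z′ ∷ columns Z″⟂ (here refl)) inᶜ meetsᶜ
    meet (_ , y∈@(there (here refl)) , u∼q) =
      clashes (inᵃ y∈) u∼q (⟂-sym p⟂q ∷ q⟂Z′) inᵇ meetsᵇ
    meet (_ , y∈@(there (there z∈)) , u∼z) =
      clashes (inᵃ y∈) u∼z (⟂-sym (All.lookup p⟂Z z∈) ∷ columns Z′⟂ (there y∈)) inᵇ meetsᵇ

-- Classical dichotomies: cones, clusters and cliques.

module _ (em : ExcludedMiddle 0ℓ) where

  transition : ∀ {P : ℕ → Set} → ¬ P 0 → ∀ n → P n → ∃[ m ] (¬ P m × P (suc m))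
  transition ¬P0 zero P0 = contradiction P0 ¬P0
  transition {P} ¬P0 (suc n) Psn with em {P n}
  ... | yes Pn = transition ¬P0 n Pn
  ... | no ¬Pn = n , ¬Pn , Psn

  stable : ∀ {P : Set} → ¬ ¬ P → P
  stable = decidable-stable em

  ¬∀⇒∃¬ : ∀ {P : V → Set} → ¬ (∀ x → P x) → ∃[ x ] ¬ P x
  ¬∀⇒∃¬ ¬∀ = stable (λ ¬∃ → ¬∀ (λ x → stable (λ ¬Px → ¬∃ (x , ¬Px))))

  -- The invariant `P` is strengthened by relatedness to the head before recursing, so that the head
  -- can be put back afterwards.
  split : ∀ {P : V → Set} (Q : V → Set) m n {xs} → AllPairs R xs → All P xs → length xs ≡ m + n →
    (∃[ ys ] (length ys ≡ m × AllPairs R ys × All P ys × All Q ys)) ⊎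
    (∃[ ys ] (length ys ≡ n × AllPairs R ys × All P ys × All (¬_ ∘ Q) ys))
  split Q zero    n       _ _ _ = inj₁ ([] , refl , [] , [] , [])
  split Q (suc m) zero    _ _ _ = inj₂ ([] , refl , [] , [] , [])
  split {R = R} {P} Q (suc m) (suc n) {x ∷ xs} (r ∷ rs) (p ∷ ps) len with em {Q x}
  ... | yes q = case split Q m (suc n) rs (All.zip (ps , r)) (suc-injective len) of λ where
    (inj₁ (ys , len′ , rs′ , prs , qs)) → let ps′ , r′ = All.unzip prs in
      inj₁ (x ∷ ys , cong suc len′ , r′ ∷ rs′ , p ∷ ps′ , q ∷ qs)
    (inj₂ (ys , len′ , rs′ , prs , qs)) → inj₂ (ys , len′ , rs′ , All.map proj₁ prs , qs)
  ... | no ¬q = case split Q (suc m) n rs (All.zip (ps , r)) (suc-injective (trans len (cong suc (+-suc m n)))) of λ where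
    (inj₁ (ys , len′ , rs′ , prs , qs)) → inj₁ (ys , len′ , rs′ , All.map proj₁ prs , qs)
    (inj₂ (ys , len′ , rs′ , prs , qs)) → let ps′ , r′ = All.unzip prs in
      inj₂ (x ∷ ys , cong suc len′ , r′ ∷ rs′ , p ∷ ps′ , ¬q ∷ qs)

  -- By transfer, whether an independent set has a common neighbour depends only on its size.
  -- Without cones there is a largest size s that has one: s ≤ 1 leaves no two distinct nonadjacent
  -- neighbours of a vertex, and s ≥ 2 is impossible.
  coned⊎cluster : ∀ G → Extensible G → Coned (complement G) → Coned G ⊎ Cluster G
  coned⊎cluster G ext coned′ with em {Coned G}
  ... | yes coned = inj₁ coned
  ... | no ¬coned = inj₂ cluster
    where
    open Graph G
    open Transfer G ext

    Uncovered : ℕ → Set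
    Uncovered n = ∃[ Z ] (Independent G Z × length Z ≡ n × ¬ (∃[ u ] All (u ∼_) Z))

    uncovered-some : ∃[ n ] Uncovered n
    uncovered-some =
      let U , ¬U = ¬∀⇒∃¬ ¬coned
          Z , lenZ , indZ , _ = fresh G coned′ (length U) []
      in length U , Z , indZ , lenZ , λ (v , v∼Z) →
           let u , _ , u∼U = transfer [] [] {v} [] Z U lenZ indZ (All.tabulate (λ _ → [])) v∼Z
           in ¬U (u , u∼U)

    ¬uncovered₀ : ¬ Uncovered 0
    ¬uncovered₀ ([] , _ , _ , ¬u) = ¬u (proj₁ (coned′ []) , [])

    cluster : Cluster G
    cluster u {x} {y} u∼x u∼y
      with transition {Uncovered} ¬uncovered₀ (proj₁ uncovered-some) (proj₂ uncovered-some)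
    ... | s , ¬uncovered , (Z , indZ , lenZ , ¬Z) = go s refl
      where
      neg : ∀ e u → Independent G e → length e ≡ suc s → ¬ All (u ∼_) e
      neg e u indE lenE u∼e =
        let w , _ , w∼Z = transfer [] [] {u} [] e Z (trans lenE (sym lenZ)) indE (All.tabulate (λ _ → [])) u∼e
        in ¬Z (w , w∼Z)

      pos : ∀ e → Independent G e → length e ≡ s → ∃[ u ] All (u ∼_) e
      pos e indE lenE = stable (λ ¬e → ¬uncovered (e , indE , lenE , ¬e))

      go : ∀ s′ → s ≡ s′ → x ≡ y ⊎ x ∼ y
      go 0 refl = contradiction (u∼x ∷ []) (neg (x ∷ []) u ([] ∷ []) refl)
      go 1 refl with em {x ≡ y} | em {x ∼ y}
      ... | yes x≡y | _       = inj₁ x≡y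
      ... | no _    | yes x∼y = inj₂ x∼y
      ... | no x≢y  | no x≁y  =
        contradiction (u∼x ∷ u∼y ∷ []) (neg (x ∷ y ∷ []) u (((x≢y , x≁y) ∷ []) ∷ [] ∷ []) refl)
      go (suc (suc t)) refl = ⊥-elim (Fans.impossible em G ext coned′ t pos neg)

  module _ (G : Graph) (avoid : ∀ (L : List V⟨ G ⟩) → ∃[ v ] All (v ≢_) L)
    (ext : Extensible G) (ext′ : Extensible (complement G)) where
    open Graph G

    InfiniteDegree : Vertex → Set
    InfiniteDegree u = ∀ L → ∃[ v ] (u ∼ v × All (v ≢_) L)

    -- Mapping n neighbours of `u` onto an n-clique, an image of `u` enlarges that clique.
    infiniteDegree⇒cliques : ∀ {u} → InfiniteDegree u → CliquesOfAllSizes G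
    infiniteDegree⇒cliques {u} inf zero    = [] , [] , refl
    infiniteDegree⇒cliques {u} inf (suc n) =
      let K , cl , lenK = infiniteDegree⇒cliques inf n
          N , lenN , uniq , u∼N = neighbours n
          w , w∼K = Transfer.cliqueTransfer G ext uniq cl (trans lenN (sym lenK)) u∼N
      in w ∷ K , w∼K ∷ cl , cong suc lenK
      where
      neighbours : ∀ n → ∃[ N ] (length N ≡ n × Unique N × All (u ∼_) N)
      neighbours zero    = [] , refl , [] , []
      neighbours (suc n) =
        let N , lenN , uniq , u∼N = neighbours n
            v , u∼v , v≢N = inf N
        in v ∷ N , cong suc lenN , v≢N ∷ uniq , u∼v ∷ u∼N

    finiteDegrees⇒coned′ : (∀ u → ¬ InfiniteDegree u) → Coned (complement G)
    finiteDegrees⇒coned′ fin L =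
      let v , v≢ = avoid (L ++ neighbours L)
          v≢L , v≢N = All.++⁻ L v≢
      in v , All.zip (v≢L , All.map (λ cov v∼x → All.lookup v≢N (cov v (∼-sym v∼x)) refl) (covered L))
      where
      cover : ∀ u → ∃[ C ] (∀ {v} → u ∼ v → v ∈ C)
      cover u = let C , ¬C = ¬∀⇒∃¬ (fin u) in
        C , λ {v} u∼v → stable (λ v∉C → ¬C (v , u∼v , All.¬Any⇒All¬ C v∉C))
      neighbours : List Vertex → List Vertex
      neighbours []      = []
      neighbours (x ∷ L) = proj₁ (cover x) ++ neighbours L
      covered : ∀ L → All (λ x → ∀ v → x ∼ v → v ∈ neighbours L) L
      covered []      = []
      covered (x ∷ L) = (λ v x∼v → ∈-++⁺ˡ (proj₂ (cover x) x∼v)) ∷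
        All.map (λ cov v x∼v → ∈-++⁺ʳ (proj₁ (cover x)) (cov v x∼v)) (covered L)

    AvoidsClique : ℕ → Set
    AvoidsClique m = ∃[ w ] ∃[ Q ] (Clique G Q × length Q ≡ m × All (λ a → ¬ w ∼ a) Q)

    -- In the complement the clique is an independent set with common neighbour `w`, and transfer
    -- carries it to any `L`.
    avoidsCliques⇒coned′ : (∀ m → AvoidsClique m) → Coned (complement G)
    avoidsCliques⇒coned′ avoids L
      -- The extra member `a` is adjacent to all of `Q` but not to `w`, which shows that `w` is
      -- outside `Q`.
      with w , a ∷ Q , a∼Q ∷ cl , lenQ , w≁a ∷ w≁Q ← avoids (suc (length L)) =
      let u , _ , u∼L = Transfer.transfer (complement G) ext′ [] [] {w} [] Q L (suc-injective lenQ)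
            (AllPairs.map (λ x∼y → (λ x≡y → loopless x≡y x∼y) , λ (_ , x≁y) → x≁y x∼y) cl)
            (All.tabulate (λ _ → []))
            (All.zipWith (λ { (a∼x , w≁x) → (λ { refl → w≁a (∼-sym a∼x) }) , w≁x }) (a∼Q , w≁Q))
      in u , u∼L

    -- Each vertex is nonadjacent to fewer than m members of any clique. Starting from a large
    -- clique, m members are set aside for each vertex of `L`, and those left are adjacent to all of
    -- `L`.
    ¬avoidsClique⇒coned : CliquesOfAllSizes G → ∀ {m} → ¬ AvoidsClique m → Coned G
    ¬avoidsClique⇒coned cliques {m} ¬avoids L = case over L 1 of λ { (u ∷ [] , _ , _ , u∼L ∷ []) → u , u∼L }
      where
      over : ∀ L n → ∃[ K ] (length K ≡ n × Clique G K × All (λ k → All (k ∼_) L) K)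
      over []      n = let K , cl , lenK = cliques n in K , lenK , cl , All.tabulate (λ _ → [])
      over (x ∷ L) n with K , lenK , cl , K∼L ← over L (n + m) | split (_∼ x) n m cl K∼L lenK
      ... | inj₁ (K′ , lenK′ , cl′ , K′∼L , K′∼x) =
        K′ , lenK′ , cl′ , All.zipWith (λ (∼x , ∼L) → ∼x ∷ ∼L) (K′∼x , K′∼L)
      ... | inj₂ (Q , lenQ , clQ , _ , Q≁x) =
        contradiction (x , Q , clQ , lenQ , All.map (_∘ ∼-sym) Q≁x) ¬avoids

    coned⊎coned′ : Coned G ⊎ Coned (complement G)
    coned⊎coned′ with em {∃[ u ] InfiniteDegree u} | em {∀ m → AvoidsClique m}
    ... | no fin      | _         = inj₂ (finiteDegrees⇒coned′ (λ u inf → fin (u , inf)))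
    ... | yes _       | yes avoids = inj₂ (avoidsCliques⇒coned′ avoids)
    ... | yes (_ , inf) | no ¬avoids =
      inj₁ (¬avoidsClique⇒coned (infiniteDegree⇒cliques inf) (proj₂ (¬∀⇒∃¬ ¬avoids)))

  -- Back-and-forth for an arbitrary compatibility relation.

  module BackAndForth {V W : Set} (Compat : Rel (V × W) 0ℓ) (Compat-sym : Symmetric Compat)
    (distinct : ∀ {p q} → Compat p q → proj₁ p ≢ proj₁ q)
    (enumV : Enumerable V) (enumW : Enumerable W)
    (forth : ∀ L → AllPairs Compat L → ∀ x → All (λ p → x ≢ proj₁ p) L → ∃[ y ] All (Compat (x , y)) L)
    (back : ∀ L → AllPairs Compat L → ∀ y → All (λ p → y ≢ proj₂ p) L → ∃[ x ] All (Compat (x , y)) L)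
    (L₀ : List (V × W)) (rel₀ : AllPairs Compat L₀) where

    Stage : Set
    Stage = ∃[ L ] AllPairs Compat L

    infix 4 _⊑_
    _⊑_ : Stage → Stage → Set
    (L , _) ⊑ (L′ , _) = ∀ {p} → p ∈ L → p ∈ L′

    addSource : (s : Stage) → ∀ x → ∃[ s′ ] (s ⊑ s′ × ∃[ y ] (x , y) ∈ proj₁ s′)
    addSource s@(L , rel) x with em {Any (λ p → x ≡ proj₁ p) L}
    ... | yes any with (_ , y) , p∈ , refl ← find any = s , id , y , p∈
    ... | no none = let y , rel-y = forth L rel x (All.¬Any⇒All¬ L none) in
      ((x , y) ∷ L , rel-y ∷ rel) , there , y , here refl

    addTarget : (s : Stage) → ∀ y → ∃[ s′ ] (s ⊑ s′ × ∃[ x ] (x , y) ∈ proj₁ s′)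
    addTarget s@(L , rel) y with em {Any (λ p → y ≡ proj₂ p) L}
    ... | yes any with (x , _) , p∈ , refl ← find any = s , id , x , p∈
    ... | no none = let x , rel-x = back L rel y (All.¬Any⇒All¬ L none) in
      ((x , y) ∷ L , rel-x ∷ rel) , there , x , here refl

    afterSource stage : ℕ → Stage
    afterSource n = proj₁ (addSource (stage n) (proj₁ enumV n))
    stage zero    = L₀ , rel₀
    stage (suc n) = proj₁ (addTarget (afterSource n) (proj₁ enumW n))

    stage-step : ∀ n → stage n ⊑ stage (suc n)
    stage-step n = proj₁ (proj₂ (addTarget (afterSource n) (proj₁ enumW n))) ∘
                   proj₁ (proj₂ (addSource (stage n) (proj₁ enumV n)))

    stage-mono : ∀ m n → stage n ⊑ stage (m + n)
    stage-mono zero    n = id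
    stage-mono (suc m) n = stage-step (m + n) ∘ stage-mono m n

    Reached : V × W → Set
    Reached p = ∃[ n ] p ∈ proj₁ (stage n)

    reached-related : ∀ {p q} → Reached p → Reached q → p ≢ q → Compat p q
    reached-related {p} {q} (m , p∈) (n , q∈) = ∈-related Compat-sym (proj₂ (stage (m + n)))
      (subst (λ k → p ∈ proj₁ (stage k)) (+-comm n m) (stage-mono n m p∈)) (stage-mono m n q∈)

    reached-functional : ∀ {x y y′} → Reached (x , y) → Reached (x , y′) → y ≡ y′
    reached-functional {x} {y} {y′} r r′ = stable λ y≢y′ →
      distinct (reached-related r r′ (y≢y′ ∘ cong proj₂)) refl

    image : ∀ x → ∃[ y ] Reached (x , y)
    image x with n , refl ← proj₂ enumV x =
      let _ , _ , y , xy∈ = addSource (stage n) (proj₁ enumV n)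
      in y , suc n , proj₁ (proj₂ (addTarget (afterSource n) (proj₁ enumW n))) xy∈

    preimage : ∀ y → ∃[ x ] Reached (x , y)
    preimage y with n , refl ← proj₂ enumW y =
      let _ , _ , x , xy∈ = addTarget (afterSource n) (proj₁ enumW n) in x , suc n , xy∈

    -- Surjectivity comes from the targets added at each stage; injectivity and reflection of edges,
    -- where wanted, are read off `Compat`.
    limit : ∃[ F ] ((∀ {x x′} → x ≢ x′ → Compat (x , F x) (x′ , F x′)) ×
      Surjective _≡_ _≡_ F × All (λ p → F (proj₁ p) ≡ proj₂ p) L₀)
    limit = proj₁ ∘ image ,
      (λ {x} {x′} x≢x′ → reached-related (proj₂ (image x)) (proj₂ (image x′)) (x≢x′ ∘ cong proj₁)) ,
      (λ y → let x , r = preimage y in x , λ { refl → reached-functional (proj₂ (image x)) r }) ,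
      All.tabulate (λ {p} p∈ → reached-functional (proj₂ (image (proj₁ p))) (0 , p∈))

  -- From homogeneity to one-point extensions.

  -- Keeping one preimage of each target makes a partial homomorphism injective without losing any
  -- target that a neighbour of v can have.
  thin : ∀ G v L → AllPairs (HomRel G G) L → ∃[ L₀ ] (AllPairs (MonoRel G G) L₀ ×
    All (λ p → Graph._∼_ G v (proj₁ p)) L₀ × (∀ {p} → p ∈ L₀ → p ∈ L) ×
    All (λ p → Graph._∼_ G v (proj₁ p) → Any (λ q → proj₂ p ≡ proj₂ q) L₀) L)
  thin G v [] [] = [] , [] , [] , id , []
  thin G v ((x , y) ∷ L) (hom ∷ homs)
    with L₀ , mono , v∼ , L₀⊆L , covers ← thin G v L homs
    with em {Graph._∼_ G v x} | em {Any (λ q → y ≡ proj₂ q) L₀}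
  ... | no v≁x  | _      = L₀ , mono , v∼ , there ∘ L₀⊆L , (λ v∼x → contradiction v∼x v≁x) ∷ covers
  ... | yes _   | yes y∈ = L₀ , mono , v∼ , there ∘ L₀⊆L , (λ _ → y∈) ∷ covers
  ... | yes v∼x | no y∉  = (x , y) ∷ L₀ ,
    All.tabulate (λ q∈ → let x≢ , h = All.lookup hom (L₀⊆L q∈) in
      x≢ , All.lookup (All.¬Any⇒All¬ L₀ y∉) q∈ , h) ∷ mono ,
    v∼x ∷ v∼ , (λ { (here refl) → here refl ; (there q∈) → there (L₀⊆L q∈) }) ,
    (λ _ → here refl) ∷ All.map (there ∘_) covers

  mono⇒extensible : ∀ G → (∀ L → AllPairs (MonoRel G G) L → ∀ v → All (λ p → Graph._∼_ G v (proj₁ p)) L →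
    ∃[ w ] All (λ p → Graph._∼_ G w (proj₂ p)) L) → Extensible G
  mono⇒extensible G ext L hom v =
    let L₀ , mono , v∼ , _ , covers = thin G v L hom
        w , w∼ = ext L₀ mono v v∼
    in w , All.map (λ cov v∼x → let q , q∈ , y≡ = find (cov v∼x) in
         subst (Graph._∼_ G w) (sym y≡) (All.lookup w∼ q∈)) covers

  -- A monomorphism of complements, read backwards, preserves the edges of `G`; the contrapositive
  -- of a backward extension in `G` is a forward extension in the complement.
  backExtensible⇒extensible′ : ∀ G → BackExtensible G → Extensible (complement G)
  backExtensible⇒extensible′ G back = mono⇒extensible (complement G) λ L mono v v⟂ →
    let u , u∼ = back (map swap L)
          (AllPairs.map⁺ (AllPairs.map (λ (x≢ , y≢ , h) → y≢ , x≢ , λ y∼y′ →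
            stable (λ x≁x′ → proj₂ (h (x≢ , x≁x′)) y∼y′)) mono))
          v (All.map⁺ (All.map proj₁ v⟂))
    in u , All.zipWith (λ ((u≢ , h) , (_ , v≁)) → u≢ , v≁ ∘ h) (All.map⁻ u∼ , v⟂)

  module _ (Y : GlobalKind) (G : Graph) (hom : Homogeneous M Y G) where

    extendMono : ∀ L → AllPairs (MonoRel G G) L →
      ∃[ F ] (IsGlobalMorphism Y G F × All (λ p → F (proj₁ p) ≡ proj₂ p) L)
    extendMono L mono =
      -- Sources and targets are both indexed by positions in `L`, so the local map is the identity
      -- on indices.
      let F , global , F≡ = hom (enumerate proj₁ proj₁) (enumerate proj₂ (proj₁ ∘ proj₂)) id
            ((λ i j x∼x′ → proj₂ (proj₂ (rel {i} {j} λ { refl → Graph.loopless G refl x∼x′ })) x∼x′) , id)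
      in F , global , All.tabulate (λ p∈ →
           subst (λ p → F (proj₁ p) ≡ proj₂ p) (sym (lookup-index p∈)) (F≡ (Any.index p∈)))
      where
      rel : ∀ {i j} → i ≢ j → MonoRel G G (lookup L i) (lookup L j)
      rel = lookup-related (λ {p} {q} → MonoRel-sym G G {p} {q}) mono
      enumerate : (π : V⟨ G ⟩ × V⟨ G ⟩ → V⟨ G ⟩) →
        (∀ {p q} → MonoRel G G p q → π p ≢ π q) → FiniteVertexSet G
      enumerate π π≢ = length L , mk↣ {to = π ∘ lookup L} λ {i} {j} πi≡πj →
        decidable-stable (i Fin.≟ j) (λ i≢j → π≢ (rel i≢j) πi≡πj)

  module _ (G : Graph) (me : Homogeneous M E G) where
    open Graph G

    ME⇒extensible : Extensible G
    ME⇒extensible = mono⇒extensible G λ L mono v v∼ →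
      let F , (F-hom , _) , F≡ = extendMono E G me L mono
      in F v , All.zipWith (λ (v∼x , Fx≡y) → subst (F v ∼_) Fx≡y (F-hom v _ v∼x)) (v∼ , F≡)

    -- Any preimage of `w` under a surjective extension serves; it is not a source because `w` is
    -- not a target.
    ME⇒backExtensible : BackExtensible G
    ME⇒backExtensible L mono w w≢ =
      let F , (F-hom , F-surj) , F≡ = extendMono E G me L mono
          v , Fv≡w = F-surj w
      in v , All.zipWith (λ (w≢y , Fx≡y) →
           (λ v≡x → w≢y (trans (sym (Fv≡w refl)) (trans (cong F v≡x) Fx≡y))) ,
           (λ v∼x → subst (_∼ _) (Fv≡w refl) (subst (F v ∼_) Fx≡y (F-hom v _ v∼x)))) (w≢ , F≡)

  -- From one-point extensions to homogeneity.

  module _ (G : Graph) (enum : Enumerable V⟨ G ⟩) where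
    open Graph G

    HE-criterion : Extensible G → HomBackExtensible G → Homogeneous H E G
    HE-criterion ext back S T f f-hom =
      let F , rel , surj , F≡ = BackAndForth.limit (HomRel G G) (λ {p} {q} → HomRel-sym G G {p} {q})
            proj₁ enum enum
            (λ L homs v v≢ → let w , w∼ = ext L homs v in w , All.zip (v≢ , w∼))
            back (tabulate graph) (AllPairs.tabulate⁺ λ {i} {j} i≢j →
              i≢j ∘ Injection.injective (proj₂ S) , f-hom i j)
      in F , ((λ x y x∼y → proj₂ (rel λ x≡y → loopless x≡y x∼y) x∼y) , surj) , All.tabulate⁻ F≡
      where
      graph : Fin (proj₁ S) → Vertex × Vertex
      graph i = vertexAt {G} S i , vertexAt {G} T (f i)

    MB-criterion : (∀ L → AllPairs (MonoRel G G) L → ∀ v → All (λ p → v ≢ proj₁ p) L →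
        ∃[ w ] All (λ (x , y) → w ≢ y × (v ∼ x → w ∼ y)) L) →
      BackExtensible G → Homogeneous M B G
    MB-criterion forth back S T f (f-hom , f-inj) =
      let F , rel , surj , F≡ = BackAndForth.limit (MonoRel G G) (λ {p} {q} → MonoRel-sym G G {p} {q})
            proj₁ enum enum
            (λ L mono v v≢ → let w , w∼ = forth L mono v v≢ in w , All.zip (v≢ , w∼))
            (λ L mono w w≢ → let v , v∼ = back L mono w w≢ in
              v , All.zipWith (λ (w≢y , v≢x , h) → v≢x , w≢y , h) (w≢ , v∼))
            (tabulate graph) (AllPairs.tabulate⁺ λ {i} {j} i≢j →
              i≢j ∘ Injection.injective (proj₂ S) , i≢j ∘ f-inj ∘ Injection.injective (proj₂ T) , f-hom i j)
      in F , ((λ x y x∼y → proj₂ (proj₂ (rel λ x≡y → loopless x≡y x∼y)) x∼y) ,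
              (λ {x} {y} Fx≡Fy → stable λ x≢y → proj₁ (proj₂ (rel x≢y)) Fx≡Fy) , surj) , All.tabulate⁻ F≡
      where
      graph : Fin (proj₁ S) → Vertex × Vertex
      graph i = vertexAt {G} S i , vertexAt {G} T (f i)

  -- Backward extension of maps that need not be injective.

  module _ (G : Graph) (enum : Enumerable V⟨ G ⟩)
    (avoid : ∀ (L : List V⟨ G ⟩) → ∃[ v ] All (v ≢_) L)
    (ext : Extensible G) (back : BackExtensible G) where
    open Graph G

    ext′ : Extensible (complement G)
    ext′ = backExtensible⇒extensible′ G back

    -- Send x₁ to y₁ and the other vertices to a clique of common neighbours of w and y₁: this is
    -- a monomorphism whatever the edges of the source, and a preimage of w is the vertex sought.
    nonneighbour : Coned G → ∀ {w y₁} x₁ R → w ≢ y₁ → ¬ w ∼ y₁ →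
      ∃[ v ] (All (v ≢_) (x₁ ∷ R) × ¬ v ∼ x₁)
    nonneighbour coned {w} {y₁} x₁ R w≢y₁ w≁y₁ =
      let L , mono , w≢ , x₁∈ , ⊇ = spread R
          v , v∼ = back L mono w w≢
          avoids = λ {x} (x∈ : Any (λ p → x ≡ proj₁ p) L) → let p , p∈ , x≡ = find x∈ in
            λ v≡x → proj₁ (All.lookup v∼ p∈) (trans v≡x x≡)
      in v , avoids (Any.map (cong proj₁) x₁∈) ∷ All.map avoids ⊇ ,
         w≁y₁ ∘ proj₂ (All.lookup v∼ x₁∈)
      where
      spread : ∀ R → ∃[ L ] (AllPairs (MonoRel G G) L × All (λ p → w ≢ proj₂ p) L ×
        (x₁ , y₁) ∈ L × All (λ x → Any (λ p → x ≡ proj₁ p) L) R)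
      spread [] = (x₁ , y₁) ∷ [] , [] ∷ [] , w≢y₁ ∷ [] , here refl , []
      spread (r ∷ R) with L , mono , w≢ , x₁∈ , ⊇ ← spread R | em {Any (λ p → r ≡ proj₁ p) L}
      ... | yes r∈ = L , mono , w≢ , x₁∈ , r∈ ∷ ⊇
      ... | no r∉ with q , q∼w ∷ q∼L ← coned (w ∷ map proj₂ L) =
        (r , q) ∷ L ,
        All.zipWith (λ (r≢ , q∼) → r≢ , (λ q≡ → loopless q≡ q∼) , λ _ → q∼)
          (All.¬Any⇒All¬ L r∉ , All.map⁻ q∼L) ∷ mono ,
        (λ w≡q → loopless (sym w≡q) q∼w) ∷ w≢ , there x₁∈ , here refl ∷ All.map there ⊇

    -- Here being equal or nonadjacent is an equivalence. The targets nonadjacent to `w` lie in one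
    -- class, so their sources do too, as an edge between sources would give one between targets. A
    -- new `v` in that class has no edges to these sources.
    cluster′⇒homBack : Coned G → Cluster (complement G) → HomBackExtensible G
    cluster′⇒homBack coned cluster′ L homs w w≢ with em {Any (λ p → ¬ w ∼ proj₂ p) L}
    ... | no none =
      let v , v≢ = avoid (map proj₁ L) in
      v , All.zipWith (λ (v≢x , w∼y) → v≢x , λ _ → stable w∼y) (All.map⁻ v≢ , All.¬Any⇒All¬ L none)
    ... | yes any =
      let (x₁ , y₁) , p₁∈ , w≁y₁ = find any
          v , v≢ , v≁x₁ = nonneighbour coned x₁ (map proj₁ L) (All.lookup w≢ p₁∈) w≁y₁
      in v , All.tabulate λ {p} p∈ →
        let v≢x = All.lookup (All.map⁻ (All.tail v≢)) p∈ in
        v≢x , λ v∼x → stable λ w≁y →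
          [ (λ { refl → v≁x₁ v∼x })
          , (λ x₁⟂x → [ (λ v≡x → v≢x v≡x) , (λ v⟂x → proj₂ v⟂x v∼x) ]′
                        (cluster′ x₁ (≢-sym (All.head v≢) , v≁x₁ ∘ ∼-sym) x₁⟂x))
          ]′ (source-class p₁∈ p∈ (All.lookup w≢ p₁∈ , w≁y₁) (All.lookup w≢ p∈ , w≁y))
      where
      source-class : ∀ {p q} → p ∈ L → q ∈ L → w ≢ proj₂ p × ¬ w ∼ proj₂ p → w ≢ proj₂ q × ¬ w ∼ proj₂ q →
        proj₁ p ≡ proj₁ q ⊎ (proj₁ p ≢ proj₁ q × ¬ proj₁ p ∼ proj₁ q)
      source-class {p} {q} p∈ q∈ w⟂p w⟂q with em {proj₁ p ≡ proj₁ q}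
      ... | yes x≡x′ = inj₁ x≡x′
      ... | no x≢x′ = inj₂ (x≢x′ , λ x∼x′ →
        let y∼y′ = proj₂ (∈-related (λ {p} {q} → HomRel-sym G G {p} {q}) homs p∈ q∈ (x≢x′ ∘ cong proj₁)) x∼x′
        in [ (λ y≡y′ → loopless y≡y′ y∼y′) , (λ y⟂y′ → proj₂ y⟂y′ y∼y′) ]′ (cluster′ w w⟂p w⟂q))

    homBack : HomBackExtensible G
    homBack with coned⊎coned′ G avoid ext ext′
    ... | inj₂ coned′ = coned′⇒homBack G coned′
    ... | inj₁ coned
      -- The dichotomy is applied to the complement, whose own complement is coned because `G` is.
      with coned⊎cluster (complement G) ext′
             (λ L → let u , u∼ = coned L in
               u , All.map (λ u∼x → (λ u≡x → loopless u≡x u∼x) , λ (_ , u≁x) → u≁x u∼x) u∼)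
    ... | inj₁ coned′  = coned′⇒homBack G coned′
    ... | inj₂ cluster′ = cluster′⇒homBack coned cluster′

    extensible⇒HE : Homogeneous H E G
    extensible⇒HE = HE-criterion G enum ext homBack

    -- The MB-homogeneous cases.

    module _ (cluster : Cluster G) (cliques : CliquesOfAllSizes G) where

      extendClique : ∀ K → Clique G K → ∃[ u ] All (u ∼_) K
      extendClique K cl with v ∷ N , v∼N ∷ clN , lenN ← cliques (suc (length K)) =
        Transfer.cliqueTransfer G ext (AllPairs.map (λ x∼y x≡y → loopless x≡y x∼y) clN) cl
          (suc-injective lenN) v∼N

      -- A member of `T` adjacent to all of `K` is added to the clique, so that the vertex found is
      -- adjacent to it and hence different; any other member differs already.
      extendCliqueAvoiding : ∀ T K → Clique G K → ∃[ u ] (All (u ∼_) K × All (u ≢_) T)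
      extendCliqueAvoiding [] K cl = let u , u∼K = extendClique K cl in u , u∼K , []
      extendCliqueAvoiding (t ∷ T) K cl with em {All (t ∼_) K}
      ... | yes t∼K = let u , u∼ , u≢T = extendCliqueAvoiding T (t ∷ K) (t∼K ∷ cl) in
        u , All.tail u∼ , (λ u≡t → loopless u≡t (All.head u∼)) ∷ u≢T
      ... | no t≁K = let u , u∼K , u≢T = extendCliqueAvoiding T K cl in
        u , u∼K , (λ { refl → t≁K u∼K }) ∷ u≢T

      cluster⇒MB : Homogeneous M B G
      cluster⇒MB = MB-criterion G enum forth back
        where
        forth : ∀ L → AllPairs (MonoRel G G) L → ∀ v → All (λ p → v ≢ proj₁ p) L →
          ∃[ w ] All (λ (x , y) → w ≢ y × (v ∼ x → w ∼ y)) L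
        forth L mono v _ =
          let u , u∼ = ext L (AllPairs.map (λ (x≢ , _ , h) → x≢ , h) mono) v
              v∼? = λ (p : Vertex × Vertex) → em {v ∼ proj₁ p}
              N = filter v∼? L
              u∼N = All.zipWith (λ (h , v∼x) → h v∼x) (All.filter⁺ v∼? u∼ , All.all-filter v∼? L)
              clN = AllPairs.map
                -- The targets have the common neighbour `u` and are distinct, so in a cluster graph
                -- they form a clique.
                (λ (u∼y , u∼y′ , _ , y≢ , _) → [ (λ y≡ → contradiction y≡ y≢) , id ]′ (cluster u u∼y u∼y′))
                (AllPairs-All (AllPairs.filter⁺ v∼? mono) u∼N)
              w , w∼N , w≢ = extendCliqueAvoiding (map proj₂ L) (map proj₂ N) (AllPairs.map⁺ clN)
          in w , All.tabulate (λ p∈ → All.lookup (All.map⁻ w≢) p∈ ,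
                   λ v∼x → All.lookup (All.map⁻ w∼N) (∈-filter⁺ v∼? p∈ v∼x))

    coned⇒MB : Coned G → Homogeneous M B G
    coned⇒MB coned = MB-criterion G enum
      (λ L _ v _ → let w , w∼ = coned (map proj₂ L) in
        w , All.map (λ w∼y → (λ w≡y → loopless w≡y w∼y) , λ _ → w∼y) (All.map⁻ w∼)) back

    edgeless⇒MB : (∀ {x y} → ¬ x ∼ y) → Homogeneous M B G
    edgeless⇒MB no-edge = MB-criterion G enum
      (λ L _ v _ → let w , w≢ = avoid (map proj₂ L) in
        w , All.map (λ w≢y → w≢y , λ v∼x → contradiction v∼x no-edge) (All.map⁻ w≢)) back

-- Disjoint unions of infinitely many copies of a finite complete graph.

-- The graph I_ω[K_n], described by extension properties suited to back-and-forth; `coned′` provides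
-- new components.
record CliqueSum (n : ℕ) (G : Graph) : Set where
  open Graph G
  field
    cluster : Cluster G
    extend  : ∀ K → Clique G K → length K < n → ∃[ u ] All (u ∼_) K
    bounded : ∀ K → Clique G K → length K ≤ n
    coned′  : Coned (complement G)

module _ (em : ExcludedMiddle 0ℓ) where

  module _ (n : ℕ) (G K : Graph) (sumG : CliqueSum n G) (sumK : CliqueSum n K) where
    private
      module G = Graph G
      module K = Graph K
      module SG = CliqueSum sumG
      module SK = CliqueSum sumK

    IsoForth : Set
    IsoForth = ∀ L → AllPairs (IsoRel G K) L → ∀ v → All (λ p → v ≢ proj₁ p) L →
      ∃[ w ] All (IsoRel G K (v , w)) L

    neighbours : G.Vertex → List (G.Vertex × K.Vertex) → List (G.Vertex × K.Vertex)
    neighbours v = filter (λ p → em {v G.∼ proj₁ p})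

    neighbours-∼ : ∀ v L → All (λ p → v G.∼ proj₁ p) (neighbours v L)
    neighbours-∼ v = All.all-filter _

    -- With `v` included, the neighbouring sources form a clique of size at most n, so their images
    -- form one of size below n, which can be extended.
    neighbour-images : ∀ v L → AllPairs (HomRel G K) L → ∃[ w ] (All (λ p → w K.∼ proj₂ p) (neighbours v L))
    neighbour-images v L homs =
      let N = neighbours v L
          clN = AllPairs.map
            (λ (v∼x , v∼x′ , x≢x′ , h) → [ (λ x≡ → contradiction x≡ x≢x′) , (λ x∼x′ → x∼x′ , h x∼x′) ]′
                                             (SG.cluster v v∼x v∼x′))
            (AllPairs-All (AllPairs.filter⁺ _ homs) (neighbours-∼ v L))
          w , w∼ = SK.extend (map proj₂ N) (AllPairs.map⁺ (AllPairs.map proj₂ clN))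
            (subst (_< n) (trans (length-map proj₁ N) (sym (length-map proj₂ N)))
              (SG.bounded (v ∷ map proj₁ N) (All.map⁺ (neighbours-∼ v L) ∷ AllPairs.map⁺ (AllPairs.map proj₁ clN))))
      in w , All.map⁻ w∼

    -- Without neighbours among the sources, `v` goes to a new component. Otherwise one neighbour
    -- `x₀` determines the component, and `same-clique` pulls membership in the component of `y₀`
    -- back to that of `x₀`.
    isoForth : IsoForth
    isoForth L iso v v≢ = go (neighbours v L) refl
      where
      related : ∀ {p q} → p ∈ L → q ∈ L → p ≢ q → IsoRel G K p q
      related = ∈-related (λ {p} {q} → IsoRel-sym G K {p} {q}) iso

      ∈-neighbours : ∀ {p} → p ∈ L → v G.∼ proj₁ p → p ∈ neighbours v L
      ∈-neighbours = ∈-filter⁺ (λ p → em {v G.∼ proj₁ p})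

      go : ∀ N → neighbours v L ≡ N → ∃[ w ] All (IsoRel G K (v , w)) L
      go [] eq =
        let w , w⟂ = SK.coned′ (map proj₂ L) in
        w , All.tabulate (λ p∈ → let w≢y , w≁y = All.lookup (All.map⁻ w⟂) p∈ in
          All.lookup v≢ p∈ , w≢y ,
          (λ v∼x → case subst (_ ∈_) eq (∈-neighbours p∈ v∼x) of λ ()) ,
          λ w∼y → contradiction w∼y w≁y)
      go ((x₀ , y₀) ∷ _) eq =
        let w , w∼ = neighbour-images v L (AllPairs.map (λ (x≢ , _ , h , _) → x≢ , h) iso)
            p₀∈N = subst ((x₀ , y₀) ∈_) (sym eq) (here refl)
            v∼x₀ = All.lookup (neighbours-∼ v L) p₀∈N
            w∼y₀ = All.lookup w∼ p₀∈N
            p₀∈L = proj₁ (∈-filter⁻ (λ p → em {v G.∼ proj₁ p}) {xs = L} p₀∈N)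
            same-clique : ∀ {p} → p ∈ L → proj₂ p ≡ y₀ ⊎ y₀ K.∼ proj₂ p → v G.∼ proj₁ p
            same-clique = λ {p} p∈ near → case em {p ≡ (x₀ , y₀)} of λ
              { (yes refl) → v∼x₀
              ; (no p≢p₀) → let _ , y≢y₀ , _ , h⁻¹ = related p∈ p₀∈L p≢p₀ in
                  [ (λ y≡y₀ → contradiction y≡y₀ y≢y₀)
                  , (λ y₀∼y → [ (λ v≡x → contradiction v≡x (All.lookup v≢ p∈)) , id ]′
                      (SG.cluster x₀ (G.∼-sym v∼x₀) (G.∼-sym (h⁻¹ (K.∼-sym y₀∼y))))) ]′ near }
        in w , All.tabulate (λ {p} p∈ →
          let forward : v G.∼ proj₁ p → w K.∼ proj₂ p
              forward v∼x = All.lookup w∼ (∈-neighbours p∈ v∼x)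
          in All.lookup v≢ p∈ ,
             -- If `w` were a target, its source would be a neighbour of `v`, making `w` adjacent to
             -- itself.
             (λ w≡y → K.loopless w≡y (forward (same-clique p∈ (inj₂ (subst (y₀ K.∼_) w≡y (K.∼-sym w∼y₀)))))) ,
             forward ,
             λ w∼y → same-clique p∈ ([ inj₁ ∘ sym , inj₂ ]′ (SK.cluster w w∼y₀ w∼y)))

  module _ (n : ℕ) (G K : Graph) (enumG : Enumerable V⟨ G ⟩) (enumK : Enumerable V⟨ K ⟩)
    (sumG : CliqueSum n G) (sumK : CliqueSum n K) where

    cliqueSum-unique : G ≅ K
    cliqueSum-unique =
      let F , rel , surj , _ = BackAndForth.limit em (IsoRel G K) (λ {p} {q} → IsoRel-sym G K {p} {q}) proj₁
            enumG enumK (isoForth n G K sumG sumK)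
            (λ L iso w w≢ → let v , v-rel = isoForth n K G sumK sumG (map swap L)
                                  (AllPairs.map⁺ (AllPairs.map (λ {p} {q} → IsoRel-swap G K {p} {q}) iso)) w (All.map⁺ w≢)
                            in v , All.map (λ {p} → IsoRel-swap K G {w , v} {swap p}) (All.map⁻ v-rel))
            [] []
      in F , (((λ x y x∼y → let _ , _ , h , _ = rel (λ x≡y → Graph.loopless G x≡y x∼y) in h x∼y) ,
               (λ {x} {y} Fx≡Fy → stable em λ x≢y → let _ , Fx≢Fy , _ = rel x≢y in Fx≢Fy Fx≡Fy)) ,
              λ x y x≁y Fx∼Fy → let _ , _ , _ , h⁻¹ = rel {x} {y} (λ { refl → Graph.loopless K refl Fx∼Fy }) in
                x≁y (h⁻¹ Fx∼Fy)) , surj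

  cliqueSum⇒HE : ∀ {n} G → Enumerable V⟨ G ⟩ → CliqueSum n G → Homogeneous H E G
  cliqueSum⇒HE {n} G enum sum = HE-criterion em G enum ext (coned′⇒homBack G (CliqueSum.coned′ sum))
    where
    ext : Extensible G
    ext L homs v = let w , w∼ = neighbour-images n G G sum sum v L homs in
      w , All.tabulate (λ p∈ v∼x → All.lookup w∼ (∈-filter⁺ (λ p → em {Graph._∼_ G v (proj₁ p)}) p∈ v∼x))

  boundedCluster⇒cliqueSum : ∀ m G → Extensible G → Coned (complement G) → Cluster G →
    ∃[ K ] (Clique G K × length K ≡ m) → ¬ (∃[ K ] (Clique G K × length K ≡ suc m)) → CliqueSum m G
  boundedCluster⇒cliqueSum m G ext coned′ cluster (K₀ , cl₀ , lenK₀) none = record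
    { cluster = cluster
    ; extend  = extend
    ; bounded = λ K cl → ≮⇒≥ λ m<K → none (take (suc m) K , AllPairs.take⁺ (suc m) cl , length-take-≤ K m<K)
    ; coned′  = coned′
    }
    where
    open Graph G
    length-take-≤ : ∀ {n} (K : List Vertex) → n ≤ length K → length (take n K) ≡ n
    length-take-≤ {n} K n≤ = trans (length-take n K) (m≤n⇒m⊓n≡m n≤)
    extend : ∀ K → Clique G K → length K < m → ∃[ u ] All (u ∼_) K
    extend K cl K<m
      -- A subclique of `K₀` one larger than `K`: its head is a common neighbour of the rest, which
      -- is transferred to `K`.
      with take (suc (length K)) K₀ | AllPairs.take⁺ (suc (length K)) cl₀
         | length-take-≤ K₀ (subst (length K <_) (sym lenK₀) K<m)
    ... | v ∷ N | v∼N ∷ clN | len =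
      Transfer.cliqueTransfer G ext (AllPairs.map (λ x∼y x≡y → loopless x≡y x∼y) clN) cl (suc-injective len) v∼N

-- The concrete graphs I_ω[K_n].

CopiesOf : ℕ → Graph
CopiesOf n = edgeless ℕ [ complete (Fin n) ]

≅-refl : ∀ G → G ≅ G
≅-refl _ = id , (((λ _ _ → id) , id) , λ _ _ → id) , λ x → x , id

copies-enumerable : ∀ n .{{_ : NonZero n}} → Enumerable (ℕ × Fin n)
copies-enumerable n = (λ k → k / n , fromℕ< (m%n<n k n)) , λ (q , r) →
  let k = q * n + toℕ r in
  k , cong₂ _,_
    (trans (+-distrib-/-∣ˡ {q * n} (toℕ r) (n∣m*n q))
      (trans (cong₂ _+_ (m*n/n≡m q n) (m<n⇒m/n≡0 (toℕ<n r))) (+-identityʳ q)))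
    (trans (fromℕ<-cong (k % n) (toℕ r)
        (trans (cong (_% n) (+-comm (q * n) (toℕ r)))
          (trans ([m+kn]%n≡m%n (toℕ r) q n) (m<n⇒m%n≡m (toℕ<n r)))) _ _)
      (fromℕ<-toℕ r (toℕ<n r)))

module _ (em : ExcludedMiddle 0ℓ) where

  -- Otherwise positions in `js` would inject n indices into fewer than n places.
  missed : ∀ {n} (js : List (Fin n)) → length js < n → ∃[ j ] j ∉ js
  missed js js<n = ¬∀⇒∃¬ em λ covers →
    let i , i′ , i<i′ , eq = pigeonhole js<n (λ j → Any.index (covers j))
    in Fin.<⇒≢ i<i′ (trans (lookup-index (covers i)) (trans (cong (lookup js) eq) (sym (lookup-index (covers i′)))))

  ≅copies⇒cliqueSum : ∀ n G .{{_ : NonZero n}} → G ≅ CopiesOf n → CliqueSum n G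
  ≅copies⇒cliqueSum n@(suc _) G (f , ((f-hom , f-inj) , f-nonadj) , f-surj) = record
    { cluster = cluster
    ; extend  = extend
    ; bounded = bounded
    ; coned′  = λ L →
        let c , c∉ = infinite-avoid id (λ n → n , refl) (map col L)
            u , fu = f-surj (c , zero)
        in u , All.map (λ c≢ → (λ { refl → c≢ (sym (cong proj₁ (fu refl))) }) ,
                 λ u∼x → c≢ (trans (sym (cong proj₁ (fu refl))) (proj₁ (f-hom′ u∼x)))) (All.map⁻ c∉)
    }
    where
    open Graph G
    -- `col` numbers the component of a vertex and `row` its place in that component.
    col : Vertex → ℕ
    col = proj₁ ∘ f
    row : Vertex → Fin n
    row = proj₂ ∘ f

    f-hom′ : ∀ {x y} → x ∼ y → col x ≡ col y × row x ≢ row y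
    f-hom′ x∼y with inj₂ p ← f-hom _ _ x∼y = p

    f-reflects : ∀ {x y} → col x ≡ col y → row x ≢ row y → x ∼ y
    f-reflects c≡ r≢ = stable em λ x≁y → f-nonadj _ _ x≁y (inj₂ (c≡ , r≢))

    cluster : Cluster G
    cluster u {x} {y} u∼x u∼y with row x Fin.≟ row y
    ... | yes r≡ = inj₁ (f-inj (cong₂ _,_ same-col r≡))
      where same-col = trans (sym (proj₁ (f-hom′ u∼x))) (proj₁ (f-hom′ u∼y))
    ... | no r≢ = inj₂ (f-reflects (trans (sym (proj₁ (f-hom′ u∼x))) (proj₁ (f-hom′ u∼y))) r≢)

    extend : ∀ K → Clique G K → length K < n → ∃[ u ] All (u ∼_) K
    extend [] _ _ = proj₁ (f-surj (0 , zero)) , []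
    extend K@(k ∷ _) (k∼K ∷ _) K<n =
      let j , j∉ = missed (map row K) (subst (_< n) (sym (length-map row K)) K<n)
          u , fu = f-surj (col k , j)
      in u , All.zipWith (λ (c≡ , r≢) → f-reflects (trans (cong proj₁ (fu refl)) c≡)
               λ r≡ → r≢ (trans (sym (cong proj₂ (fu refl))) r≡))
             (refl ∷ All.map (proj₁ ∘ f-hom′) k∼K , All.map⁻ (All.¬Any⇒All¬ (map row K) j∉))

    bounded : ∀ K → Clique G K → length K ≤ n
    bounded K cl = ≮⇒≥ λ n<K →
      let i , j , i<j , eq = pigeonhole n<K (row ∘ lookup K)
      in proj₂ (f-hom′ (lookup-related ∼-sym cl (Fin.<⇒≢ i<j))) eq

-- Classification by cones and clique sizes.

theorem8p3 : ExcludedMiddle 0ℓ →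
    (G : Graph) → CountablyInfinite G →
    (Homogeneous M E G ⇔ Homogeneous H E G) ×
    (Homogeneous H E G ⇔
    (Homogeneous M B G ⊎ (∃[ n ] (n ≥ 2 × G ≅ (edgeless ℕ [ complete (Fin n) ])))))
theorem8p3 em G G↔ℕ =
  mk⇔ ME⇒HE HE⇒ME , mk⇔ (ME⇒MB⊎copies ∘ HE⇒ME) [ ME⇒HE ∘ MB⇒ME , copies⇒HE ]′
  where
  open Graph G

  enum : Enumerable Vertex
  enum = Inverse.from G↔ℕ , λ v → Inverse.to G↔ℕ v , Inverse.strictlyInverseʳ G↔ℕ v

  avoid : ∀ (L : List Vertex) → ∃[ v ] All (v ≢_) L
  avoid L =
    let v , v≢ = infinite-avoid (Inverse.to G↔ℕ) (λ n → Inverse.from G↔ℕ n , Inverse.strictlyInverseˡ G↔ℕ n) L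
    in v , All.map (λ to≢ v≡x → to≢ (cong (Inverse.to G↔ℕ) v≡x)) v≢

  ME⇒HE : Homogeneous M E G → Homogeneous H E G
  ME⇒HE me = extensible⇒HE em G enum avoid (ME⇒extensible em G me) (ME⇒backExtensible em G me)

  HE⇒ME : Homogeneous H E G → Homogeneous M E G
  HE⇒ME he S T f (f-hom , _) = he S T f f-hom

  MB⇒ME : Homogeneous M B G → Homogeneous M E G
  MB⇒ME mb S T f f-mono =
    let F , (F-hom , _ , F-surj) , F≡ = mb S T f f-mono in F , (F-hom , F-surj) , F≡

  copies⇒HE : ∃[ n ] (n ≥ 2 × G ≅ CopiesOf n) → Homogeneous H E G
  copies⇒HE (n@(suc _) , _ , iso) = cliqueSum⇒HE em G enum (≅copies⇒cliqueSum em n G iso)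

  ME⇒MB⊎copies : Homogeneous M E G → Homogeneous M B G ⊎ ∃[ n ] (n ≥ 2 × G ≅ CopiesOf n)
  ME⇒MB⊎copies me = by-cones (coned⊎coned′ em G avoid ext ext⁻)
    where
    ext = ME⇒extensible em G me
    back = ME⇒backExtensible em G me
    ext⁻ = backExtensible⇒extensible′ em G back

    CliqueOfSize : ℕ → Set
    CliqueOfSize n = ∃[ K ] (Clique G K × length K ≡ n)

    by-size : Coned (complement G) → Cluster G → ∀ n → CliqueOfSize n → ¬ CliqueOfSize (suc n) →
      Homogeneous M B G ⊎ ∃[ n ] (n ≥ 2 × G ≅ CopiesOf n)
    by-size _ _ 0 _ none = contradiction (proj₁ (avoid []) ∷ [] , [] ∷ [] , refl) none
    -- Clique number 1 means no edges, which falls under MB; the copies begin at n = 2.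
    by-size _ _ 1 _ none = inj₁ (edgeless⇒MB em G enum avoid ext back
      λ {x} {y} x∼y → none (x ∷ y ∷ [] , (x∼y ∷ []) ∷ [] ∷ [] , refl))
    by-size coned′ cluster n@(suc (suc _)) some none = inj₂ (n , s≤s (s≤s z≤n) ,
      cliqueSum-unique em n G (CopiesOf n) enum (copies-enumerable n)
        (boundedCluster⇒cliqueSum em n G ext coned′ cluster some none)
        (≅copies⇒cliqueSum em n (CopiesOf n) (≅-refl (CopiesOf n))))

    by-cliques : Coned (complement G) → Cluster G → Homogeneous M B G ⊎ ∃[ n ] (n ≥ 2 × G ≅ CopiesOf n)
    by-cliques coned′ cluster with em {CliquesOfAllSizes G}
    ... | yes cliques = inj₁ (cluster⇒MB em G enum avoid ext back cluster cliques)
    ... | no ¬cliques =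
      let N , none = ¬∀⇒∃¬ em ¬cliques
          -- The empty clique has size 0, so some size occurs whose successor does not.
          n , some , none′ = transition em {¬_ ∘ CliqueOfSize} (λ ¬K → ¬K ([] , [] , refl)) N none
      in by-size coned′ cluster n (stable em some) none′

    by-cones : Coned G ⊎ Coned (complement G) → Homogeneous M B G ⊎ ∃[ n ] (n ≥ 2 × G ≅ CopiesOf n)
    by-cones (inj₁ coned)  = inj₁ (coned⇒MB em G enum avoid ext back coned)
    by-cones (inj₂ coned′) with coned⊎cluster em G ext coned′
    ... | inj₁ coned   = inj₁ (coned⇒MB em G enum avoid ext back coned)
    ... | inj₂ cluster = by-cliques coned′ cluster
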